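{- Let $\langle\mathbb A,\alpha\rangle$, $\langle\mathbb B,\beta\rangle$ be countable incompressible dynamical systems, $\iota$ an embedding of $\langle\mathbb A,\alpha\rangle$ into $\langle\mathbb B,\beta\rangle$, and $\eta$ an embedding of $\langle\mathbb A,\alpha\rangle$ into $\langle\mathcal P(\omega)/\mathrm{Fin},\sigma\rangle$. There exists an embedding $\bar\eta$ of $\langle\mathbb B,\beta\rangle$ into $\langle\mathcal P(\omega)/\mathrm{Fin},\sigma\rangle$ with $\bar\eta\circ\iota=\eta$ if and only if the following condition $(\dagger)$ holds: for every partition $\mathcal A$ of $\mathbb A$ and every partition $\mathcal B$ of $\mathbb B$ refining $\iota[\mathcal A]$, there are a partition $\mathcal C$ of $\mathcal P(\omega)/\mathrm{Fin}$ refining $\eta[\mathcal A]$ and a digraph isomorphism $\tilde\eta$ from $\langle\mathcal B,\to_\beta\rangle$ to $\langle\mathcal C,\to_\sigma\rangle$ such that $\tilde\eta(\iota(a))=\eta(a)$ for all $a\in\mathcal A$, where $\tilde\eta(\iota(a))$ means $\bigvee\{\tilde\eta(b):b\in\mathcal B,\ b\le\iota(a)\}$.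
   Context: $\mathcal P(\omega)/\mathrm{Fin}$ is $\mathcal P(\omega)$ modulo finite sets, $\sigma([A])=[A+1]$ the shift. A dynamical system is a Boolean algebra with an automorphism; an embedding of $\langle\mathbb A,\alpha\rangle$ into $\langle\mathbb B,\beta\rangle$ is an injective Boolean homomorphism $\eta$ with $\eta\circ\alpha=\beta\circ\eta$; incompressible means no $x\notin\{\mathbf 0,\mathbf 1\}$ has $\alpha(x)\le x$. A partition of a Boolean algebra is a finite set of nonzero pairwise disjoint elements with join $\mathbf 1$; a partition $\mathcal V$ refines a partition (or finite set) $\mathcal U$ if each member of $\mathcal V$ lies below some member of $\mathcal U$. For a partition $\mathcal U$ of a system with automorphism $\gamma$, the digraph $\langle\mathcal U,\to_\gamma\rangle$ has $x\to_\gamma y$ iff $\gamma(x)\wedge y\ne\mathbf 0$. -}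

module Defs where

open import Level as L using (Level; _⊔_; 0ℓ)
open import Data.Nat as Nat using (ℕ; zero; suc)
open import Data.Bool as Bool using (Bool; true; false; not; _xor_)
open import Data.Fin using (Fin; zero; suc)
open import Data.Product using (Σ; ∃; _×_; _,_)
open import Data.Empty renaming (⊥ to Empty)
open import Relation.Nullary using () renaming (¬_ to Not)
open import Relation.Binary.PropositionalEquality using (_≡_)
open import Function using (_∘_; _↔_; Inverse)
open import Algebra.Lattice.Bundles using (BooleanAlgebra)

-- Raw Boolean-algebra signature (carrier, setoid equality, operations).
-- Used only to speak uniformly about the algebras A, B (genuine
-- stdlib BooleanAlgebras) and P(ω)/Fin (given concretely below).

record RawBA (c ℓ : Level) : Set (L.suc (c ⊔ ℓ)) where
  infix  8 ¬_
  infixr 7 _∧_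
  infixr 6 _∨_
  infix  4 _≈_ _≤_
  field
    Carrier : Set c
    _≈_     : Carrier → Carrier → Set ℓ
    _∨_     : Carrier → Carrier → Carrier
    _∧_     : Carrier → Carrier → Carrier
    ¬_      : Carrier → Carrier
    ⊤       : Carrier
    ⊥       : Carrier

  _≤_ : Carrier → Carrier → Set ℓ
  x ≤ y = x ∧ y ≈ x

  ⋁ : ∀ {n} → (Fin n → Carrier) → Carrier
  ⋁ {zero}  f = ⊥
  ⋁ {suc n} f = f zero ∨ ⋁ (f ∘ suc)

toRaw : ∀ {c ℓ} → BooleanAlgebra c ℓ → RawBA c ℓ
toRaw 𝔸 = record
  { Carrier = Carrier ; _≈_ = _≈_ ; _∨_ = _∨_ ; _∧_ = _∧_
  ; ¬_ = ¬_ ; ⊤ = ⊤ ; ⊥ = ⊥ }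
  where open BooleanAlgebra 𝔸

module _ {c ℓ c' ℓ'} (R : RawBA c ℓ) (S : RawBA c' ℓ') where
  private
    module R = RawBA R
    module S = RawBA S

  record IsBoolHom (f : R.Carrier → S.Carrier) : Set (c ⊔ ℓ ⊔ ℓ') where
    field
      cong  : ∀ {x y} → x R.≈ y → f x S.≈ f y
      ∨-hom : ∀ x y → f (x R.∨ y) S.≈ (f x S.∨ f y)
      ∧-hom : ∀ x y → f (x R.∧ y) S.≈ (f x S.∧ f y)
      ¬-hom : ∀ x → f (R.¬ x) S.≈ S.¬ (f x)
      ⊤-hom : f R.⊤ S.≈ S.⊤
      ⊥-hom : f R.⊥ S.≈ S.⊥

  record IsEmbedding (α : R.Carrier → R.Carrier) (β : S.Carrier → S.Carrier)
                     (f : R.Carrier → S.Carrier) : Set (c ⊔ ℓ ⊔ ℓ') where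
    field
      hom       : IsBoolHom f
      injective : ∀ {x y} → f x S.≈ f y → x R.≈ y
      commutes  : ∀ x → f (α x) S.≈ β (f x)

module _ {c ℓ} (R : RawBA c ℓ) where
  open RawBA R

  record IsAutomorphism (α : Carrier → Carrier) : Set (c ⊔ ℓ) where
    field
      hom        : IsBoolHom R R α
      injective  : ∀ {x y} → α x ≈ α y → x ≈ y
      surjective : ∀ y → ∃ λ x → α x ≈ y

  Countable : Set (c ⊔ ℓ)
  Countable = Σ (ℕ → Carrier) λ e → ∀ x → ∃ λ n → e n ≈ x

  Incompressible : (Carrier → Carrier) → Set (c ⊔ ℓ)
  Incompressible α = ∀ x → α x ≤ x → Not (x ≈ ⊥) → Not (x ≈ ⊤) → Empty

  -- a partition: a finite family of nonzero pairwise disjoint elements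
  -- with join 1 (indexed by Fin n; being nonzero and pairwise disjoint,
  -- the members are pairwise distinct, so the index set is the set).
  record IsPartition {n} (p : Fin n → Carrier) : Set ℓ where
    field
      nonzero  : ∀ i → Not (p i ≈ ⊥)
      disjoint : ∀ i j → Not (i ≡ j) → p i ∧ p j ≈ ⊥
      covers   : ⋁ p ≈ ⊤

  Refines : ∀ {m n} → (Fin m → Carrier) → (Fin n → Carrier) → Set ℓ
  Refines q p = ∀ j → ∃ λ i → q j ≤ p i

  Arrow : (Carrier → Carrier) → Carrier → Carrier → Set ℓ
  Arrow γ x y = Not (γ x ∧ y ≈ ⊥)

record DynSys (c ℓ : Level) : Set (L.suc (c ⊔ ℓ)) where
  field
    alg   : BooleanAlgebra c ℓ
    aut   : BooleanAlgebra.Carrier alg → BooleanAlgebra.Carrier alg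
    isAut : IsAutomorphism (toRaw alg) aut

  raw : RawBA c ℓ
  raw = toRaw alg

  open RawBA raw public

-- P(ω)/Fin: subsets of ω as characteristic functions ℕ → Bool,
-- equality modulo finite sets, and the shift σ([A]) = [A+1].

IsFinite : (ℕ → Bool) → Set
IsFinite X = ∃ λ N → ∀ n → N Nat.≤ n → X n ≡ false

PωFin : RawBA 0ℓ 0ℓ
PωFin = record
  { Carrier = ℕ → Bool
  ; _≈_ = λ X Y → IsFinite (λ n → X n xor Y n)
  ; _∨_ = λ X Y n → X n Bool.∨ Y n
  ; _∧_ = λ X Y n → X n Bool.∧ Y n
  ; ¬_  = λ X n → not (X n)
  ; ⊤   = λ _ → true
  ; ⊥   = λ _ → false
  }

σ : (ℕ → Bool) → (ℕ → Bool)
σ X zero    = false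
σ X (suc n) = X n

module _ {c ℓ} (𝔸 𝔹 : DynSys c ℓ) where
  private
    module A = DynSys 𝔸
    module B = DynSys 𝔹
    module P = RawBA PωFin

  Dagger : (A.Carrier → B.Carrier) → (A.Carrier → ℕ → Bool) → Set (c ⊔ ℓ)
  Dagger ι η =
    ∀ {k m} (𝒜 : Fin k → A.Carrier) (ℬ : Fin m → B.Carrier) →
    IsPartition A.raw 𝒜 →
    IsPartition B.raw ℬ →
    Refines B.raw ℬ (ι ∘ 𝒜) →
    ∃ λ r → Σ (Fin r → (ℕ → Bool)) λ 𝒞 →
      IsPartition PωFin 𝒞 ×
      Refines PωFin 𝒞 (η ∘ 𝒜) ×
      Σ (Fin m ↔ Fin r) λ π →
        let η̃ = λ j → 𝒞 (Inverse.to π j) in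
        (∀ i j → (Arrow B.raw B.aut (ℬ i) (ℬ j) → Arrow PωFin σ (η̃ i) (η̃ j))
               × (Arrow PωFin σ (η̃ i) (η̃ j) → Arrow B.raw B.aut (ℬ i) (ℬ j))) ×
        -- η̃(ι a) := ⋁{ η̃(b) : b ∈ ℬ, b ≤ ι a } equals η a, for a ∈ 𝒜;
        -- i.e. η(a) is the least upper bound of that set in P(ω)/Fin
        (∀ i →
          (∀ j → ℬ j B.≤ ι (𝒜 i) → η̃ j P.≤ η (𝒜 i)) ×
          (∀ (u : ℕ → Bool) → (∀ j → ℬ j B.≤ ι (𝒜 i) → η̃ j P.≤ u) → η (𝒜 i) P.≤ u))

{-# OPTIONS --safe #-}
-- A walk in 𝔹 is a sequence w of nonzero elements; if it eventually decides
-- every x, moves along the digraph of every partition, stays below ι a whenever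
-- k ∈ η a, and is infinitely often below every nonzero x, then
-- x ↦ {k : w k ≤ x} is the extension sought.  The condition (†), applied to
-- finer and finer partitions, gives for each n a walk that does all this for
-- the first n elements of 𝔹 (w k is the block whose η̃-image contains k).
-- These walks need not cohere, but by compactness of Cantor space some
-- subsequence of them is such that its m-th and (m+1)-st members agree, at
-- infinitely many times, about the first m elements.  Switching from each
-- member to the next at such a time produces the limit walk.

module Submission where

open import Defs
open import Level using (Level; Lift; lift; lower; _⊔_; 0ℓ)
open import Data.Nat using (ℕ; zero; suc; _≤_; _<_; z≤n; s≤s; _+_)
  renaming (_⊔_ to max)
open import Data.Nat.Properties
open import Data.Bool using (Bool; true; false; _xor_)
import Data.Bool as Bool
open import Data.Bool.Properties using (xor-same; ¬-not; not-injective; ⇔→≡)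
open import Data.Fin using (Fin; zero; suc)
open import Data.Product using (Σ; ∃; _×_; _,_; proj₁; proj₂; uncurry)
open import Data.Sum using (_⊎_; inj₁; inj₂)
open import Data.Unit using (tt) renaming (⊤ to Unit)
open import Relation.Nullary using (yes; no; contradiction; Dec; does) renaming (¬_ to Not)
open import Relation.Nullary.Decidable using (map′; ¬?; _×-dec_; _⊎-dec_; does-⇔; dec-true; dec-false)
open import Relation.Binary.PropositionalEquality using (_≡_; refl; sym; trans; cong; cong₂; subst; module ≡-Reasoning)
open import Function using (_∘_; id; Inverse; mk⇔)
open import Function.Construct.Identity using (↔-id)
open import Axiom.ExcludedMiddle using (ExcludedMiddle)
open import Algebra.Lattice.Bundles using (BooleanAlgebra)
open import Data.Fin.Properties using (any?; ¬∀⟶∃¬) renaming (_≟_ to _≟ᶠ_)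
open import Data.List using (List; []; _∷_; _++_; map; foldr; filter; lookup; length; tabulate; applyUpTo)
open import Data.List.Membership.Propositional.Properties using (∈-lookup)
open import Data.List.Relation.Unary.All as All using (All; []; _∷_)
import Data.List.Relation.Unary.All.Properties as Allₚ
open import Data.List.Relation.Unary.AllPairs as AllPairs using (AllPairs; []; _∷_)
import Data.List.Relation.Unary.AllPairs.Properties as AllPairsₚ
import Algebra.Lattice.Properties.BooleanAlgebra as BAProperties
import Relation.Binary.Reasoning.Setoid as ≈-Reasoning

private
  variable
    p q : Level
    P : ℕ → Set p
    Q : ℕ → Set q

lower-em : ∀ {a} b → ExcludedMiddle (a ⊔ b) → ExcludedMiddle a
lower-em b em {P} = map′ lower lift (em {Lift b P})

-- Asymptotic quantifiers over times

Eventually : (ℕ → Set p) → Set p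
Eventually P = ∃ λ N → ∀ n → N ≤ n → P n

InfinitelyOften : (ℕ → Set p) → Set p
InfinitelyOften P = ∀ N → ∃ λ n → N ≤ n × P n

ev-always : (∀ n → P n) → Eventually P
ev-always f = 0 , λ n _ → f n

ev-map : (∀ n → P n → Q n) → Eventually P → Eventually Q
ev-map f (N , h) = N , λ n N≤n → f n (h n N≤n)

ev-∩ : Eventually P → Eventually Q → Eventually (λ n → P n × Q n)
ev-∩ (M , f) (N , g) =
  max M N , λ n le → f n (m⊔n≤o⇒m≤o M N le) , g n (m⊔n≤o⇒n≤o M N le)

ev-suc : Eventually P → Eventually (P ∘ suc)
ev-suc (N , f) = N , λ n le → f (suc n) (m≤n⇒m≤1+n le)

ev-pred : Eventually (P ∘ suc) → Eventually P
ev-pred (N , f) = suc N , λ { (suc n) (s≤s le) → f n le }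

ev-≥ : ∀ N → Eventually (N ≤_)
ev-≥ N = N , λ _ → id

ev-fin : ∀ {n} {P : Fin n → ℕ → Set p} →
  (∀ i → Eventually (P i)) → Eventually (λ k → ∀ i → P i k)
ev-fin {n = zero}  f = ev-always λ _ ()
ev-fin {n = suc n} f =
  ev-map (λ { _ (x , xs) zero → x ; _ (x , xs) (suc i) → xs i })
         (ev-∩ (f zero) (ev-fin (f ∘ suc)))

ev-below : ∀ n {P : ℕ → ℕ → Set p} →
  (∀ i → i < n → Eventually (P i)) → Eventually (λ k → ∀ i → i < n → P i k)
ev-below zero    f = ev-always λ _ _ ()
ev-below (suc n) {P} f =
  ev-map combine (ev-∩ (f n ≤-refl) (ev-below n λ i i<n → f i (m<n⇒m<1+n i<n)))
  where
  combine : ∀ k → P n k × (∀ i → i < n → P i k) → ∀ i → i < suc n → P i k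
  combine k (x , xs) i i<1+n with m<1+n⇒m<n∨m≡n i<1+n
  ... | inj₁ i<n  = xs i i<n
  ... | inj₂ refl = x

ev-if : ∀ {a p} {A : Set a} {P : ℕ → Set p} →
  Dec A → (A → Eventually P) → Eventually (λ k → A → P k)
ev-if (yes x) f = ev-map (λ _ h _ → h) (f x)
ev-if (no ¬x) _ = ev-always λ _ x → contradiction x ¬x

io-map : (∀ n → P n → Q n) → InfinitelyOften P → InfinitelyOften Q
io-map f io N with io N
... | n , N≤n , x = n , N≤n , f n x

io-ev : InfinitelyOften P → Eventually Q → InfinitelyOften (λ n → P n × Q n)
io-ev io (M , f) N with io (max M N)
... | n , le , x = n , m⊔n≤o⇒n≤o M N le , x , f n (m⊔n≤o⇒m≤o M N le)

¬ev-¬⇒io : ExcludedMiddle p → {P : ℕ → Set p} →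
  Not (Eventually (λ n → Not (P n))) → InfinitelyOften P
¬ev-¬⇒io em {P} ¬ev N with em {∃ λ n → N ≤ n × P n}
... | yes found = found
... | no ¬found = contradiction (N , λ n le x → ¬found (n , le , x)) ¬ev

¬io⇒ev-¬ : ExcludedMiddle p → {P : ℕ → Set p} →
  Not (InfinitelyOften P) → Eventually (λ n → Not (P n))
¬io⇒ev-¬ em {P} ¬io with em {Eventually (λ n → Not (P n))}
... | yes ev = ev
... | no ¬ev = contradiction (¬ev-¬⇒io em ¬ev) ¬io

-- Compactness of Cantor space

module _ (em : ExcludedMiddle 0ℓ) where

  -- If neither value recurred, both would be absent from some time on, yet `P` still holds at a
  -- later time, where `c` takes one of them.
  infinite-pigeonhole : {P : ℕ → Set} → InfinitelyOften P → (c : ℕ → Bool) →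
    ∃ λ b → InfinitelyOften (λ k → P k × c k ≡ b)
  infinite-pigeonhole {P} io c
    with em {InfinitelyOften (λ k → P k × c k ≡ true)}
       | em {InfinitelyOften (λ k → P k × c k ≡ false)}
  ... | yes io-true  | _            = true , io-true
  ... | no _         | yes io-false = false , io-false
  ... | no ¬io-true  | no ¬io-false
    with io-ev io (ev-∩ (¬io⇒ev-¬ em ¬io-true) (¬io⇒ev-¬ em ¬io-false)) 0
  ... | k , _ , x , ¬t , ¬f with c k
  ...   | true  = contradiction (x , refl) ¬t
  ...   | false = contradiction (x , refl) ¬f

  cluster-point : (s : ℕ → ℕ → Bool) →
    ∃ λ b → ∀ t → InfinitelyOften (λ k → ∀ i → i < t → s k i ≡ b i)
  cluster-point s = b , λ t → io-map (λ k → agree t k) (proj₂ (S t))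
    where
    S : ℕ → Σ (ℕ → Set) InfinitelyOften
    choice : ∀ t → ∃ λ v → InfinitelyOften (λ k → proj₁ (S t) k × s k t ≡ v)
    S zero    = (λ _ → Unit) , λ N → N , ≤-refl , tt
    S (suc t) = _ , proj₂ (choice t)
    choice t = infinite-pigeonhole (proj₂ (S t)) (λ k → s k t)

    b : ℕ → Bool
    b t = proj₁ (choice t)

    agree : ∀ t k → proj₁ (S t) k → ∀ i → i < t → s k i ≡ b i
    agree (suc t) k (x , eq) i i<1+t with m<1+n⇒m<n∨m≡n i<1+t
    ... | inj₁ i<t  = agree t k x i i<t
    ... | inj₂ refl = eq

-- Cantor's path along the antidiagonals: each runs from `(0 , s)` to `(s , 0)` and is followed by
-- `(0 , suc s)`.
next-pair : ℕ × ℕ → ℕ × ℕ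
next-pair (x , zero)  = zero , suc x
next-pair (x , suc y) = suc x , y

unpair : ℕ → ℕ × ℕ
unpair zero    = zero , zero
unpair (suc n) = next-pair (unpair n)

unpair-surjective : ∀ x y → ∃ λ n → unpair n ≡ (x , y)
unpair-surjective x y = along-diagonal (x + y) x y refl
  where
  along-diagonal : ∀ s x y → x + y ≡ s → ∃ λ n → unpair n ≡ (x , y)
  along-diagonal s       zero    zero    _  = 0 , refl
  along-diagonal (suc s) zero    (suc y) eq
    with along-diagonal s y zero (trans (+-identityʳ y) (suc-injective eq))
  ... | n , eq′ = suc n , cong next-pair eq′
  along-diagonal s       (suc x) y       eq
    with along-diagonal s x (suc y) (trans (+-suc x y) eq)
  ... | n , eq′ = suc n , cong next-pair eq′

-- Two limits are taken: first in the time k, along times at which every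
-- χ n converges, and then of the resulting limits in the stage n.
recurrent-agreement : ExcludedMiddle 0ℓ → (χ : ℕ → ℕ → ℕ → Bool) →
  ∃ λ (ν : ℕ → ℕ) → (∀ m → m ≤ ν m) ×
    ∀ m → InfinitelyOften (λ k → ∀ i → i < m → χ (ν m) k i ≡ χ (ν (suc m)) k i)
recurrent-agreement em χ = ν , (λ m → proj₁ (proj₂ (stage m))) , agreement
  where
  in-time : ∃ λ b → ∀ t → InfinitelyOften
    (λ k → ∀ i → i < t → χ (proj₁ (unpair i)) k (proj₂ (unpair i)) ≡ b i)
  in-time = cluster-point em λ k i → χ (proj₁ (unpair i)) k (proj₂ (unpair i))

  code : ℕ → ℕ → ℕ
  code n i = proj₁ (unpair-surjective n i)

  L : ℕ → ℕ → Bool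
  L n i = proj₁ in-time (code n i)

  in-stage : ∃ λ b → ∀ t → InfinitelyOften (λ n → ∀ i → i < t → L n i ≡ b i)
  in-stage = cluster-point em L

  -- Consecutive stages agree on their first `m` limit bits because both agree there with the same
  -- limit `proj₁ in-stage`.
  stage : ∀ m → ∃ λ n → m ≤ n × (∀ i → i < m → L n i ≡ proj₁ in-stage i)
  stage m = proj₂ in-stage m m

  ν : ℕ → ℕ
  ν m = proj₁ (stage m)

  at-limit : ∀ {t k} → (∀ i → i < t → χ (proj₁ (unpair i)) k (proj₂ (unpair i)) ≡ proj₁ in-time i) →
    ∀ n i → code n i < t → χ n k i ≡ L n i
  at-limit {k = k} conv n i lt =
    trans (cong (λ c → χ (proj₁ c) k (proj₂ c)) (sym (proj₂ (unpair-surjective n i))))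
          (conv (code n i) lt)

  agreement : ∀ m → InfinitelyOften
    (λ k → ∀ i → i < m → χ (ν m) k i ≡ χ (ν (suc m)) k i)
  agreement m = io-map agree (proj₂ in-time t)
    where
    codes-below : Eventually λ t →
      (∀ i → i < m → code (ν m) i < t) × (∀ i → i < m → code (ν (suc m)) i < t)
    codes-below = ev-∩ (ev-below m λ i _ → ev-≥ _) (ev-below m λ i _ → ev-≥ _)

    -- Times at which the first `t` coded bits have their limit values recur; this `t` exceeds the
    -- codes of all bits `i < m` of both stages.
    t : ℕ
    t = proj₁ codes-below

    agree : ∀ k → (∀ i → i < t → χ (proj₁ (unpair i)) k (proj₂ (unpair i)) ≡ proj₁ in-time i) →
      ∀ i → i < m → χ (ν m) k i ≡ χ (ν (suc m)) k i
    agree k conv i i<m with proj₂ codes-below t ≤-refl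
    ... | below , below′ = begin
      χ (ν m) k i        ≡⟨ at-limit conv (ν m) i (below i i<m) ⟩
      L (ν m) i          ≡⟨ proj₂ (proj₂ (stage m)) i i<m ⟩
      proj₁ in-stage i   ≡⟨ proj₂ (proj₂ (stage (suc m))) i (m<n⇒m<1+n i<m) ⟨
      L (ν (suc m)) i    ≡⟨ at-limit conv (ν (suc m)) i (below′ i i<m) ⟨
      χ (ν (suc m)) k i  ∎
      where open ≡-Reasoning

levels : (K : ℕ → ℕ) → K 0 ≡ 0 → (∀ m → K m < K (suc m)) →
  ∀ k → ∃ λ m → K m ≤ k × k < K (suc m)
levels K K0 K< zero    = 0 , ≤-reflexive K0 , subst (_< K 1) K0 (K< 0)
levels K K0 K< (suc k) with levels K K0 K< k
... | m , Km≤k , k<Km+1 with m≤n⇒m<n∨m≡n k<Km+1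
...   | inj₁ lt = m , m≤n⇒m≤1+n Km≤k , lt
...   | inj₂ eq = suc m , ≤-reflexive (sym eq) , subst (_< K (suc (suc m))) (sym eq) (K< (suc m))

-- Order and finite partitions in a Boolean algebra

module Order {c ℓ} (𝔹 : BooleanAlgebra c ℓ) where
  open BooleanAlgebra 𝔹 renaming (trans to ≈-trans; sym to ≈-sym; refl to ≈-refl)
  open BAProperties 𝔹
  open RawBA (toRaw 𝔹) using (⋁) renaming (_≤_ to _≼_)
  open ≈-Reasoning setoid

  -- A nonzero `v` that decides finitely many elements acts on them like an ultrafilter.
  Decides : Carrier → Carrier → Set ℓ
  Decides v x = v ≼ x ⊎ v ≼ ¬ x

  ≼-refl : ∀ {x} → x ≼ x
  ≼-refl = ∧-idem _

  ≼-trans : ∀ {x y z} → x ≼ y → y ≼ z → x ≼ z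
  ≼-trans {x} {y} {z} x≼y y≼z = begin
    x ∧ z        ≈⟨ ∧-congʳ x≼y ⟨
    (x ∧ y) ∧ z  ≈⟨ ∧-assoc x y z ⟩
    x ∧ (y ∧ z)  ≈⟨ ∧-congˡ y≼z ⟩
    x ∧ y        ≈⟨ x≼y ⟩
    x            ∎

  ≼-respʳ : ∀ {x y z} → y ≈ z → x ≼ y → x ≼ z
  ≼-respʳ y≈z x≼y = ≈-trans (∧-congˡ (≈-sym y≈z)) x≼y

  x∧y≼y : ∀ x y → x ∧ y ≼ y
  x∧y≼y x y = ≈-trans (∧-assoc x y y) (∧-congˡ (∧-idem y))

  x∧y≼x : ∀ x y → x ∧ y ≼ x
  x∧y≼x x y = ≈-trans (∧-congʳ (∧-comm x y))
    (≈-trans (x∧y≼y y x) (∧-comm y x))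

  ∧-greatest : ∀ {v x y} → v ≼ x → v ≼ y → v ≼ x ∧ y
  ∧-greatest {v} {x} {y} v≼x v≼y =
    ≈-trans (≈-sym (∧-assoc v x y)) (≈-trans (∧-congʳ v≼x) v≼y)

  ∧-mono : ∀ {x x′ y y′} → x ≼ x′ → y ≼ y′ → x ∧ y ≼ x′ ∧ y′
  ∧-mono p q = ∧-greatest (≼-trans (x∧y≼x _ _) p) (≼-trans (x∧y≼y _ _) q)

  ≼⊥⇒≈⊥ : ∀ {x} → x ≼ ⊥ → x ≈ ⊥
  ≼⊥⇒≈⊥ {x} x≼⊥ = ≈-trans (≈-sym x≼⊥) (∧-zeroʳ x)

  x≼x∨y : ∀ x y → x ≼ x ∨ y
  x≼x∨y x y = ∧-absorbs-∨ x y

  y≼x∨y : ∀ x y → y ≼ x ∨ y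
  y≼x∨y x y = ≼-respʳ (∨-comm y x) (x≼x∨y y x)

  contradictory : ∀ {v x} → v ≼ x → v ≼ ¬ x → v ≈ ⊥
  contradictory {x = x} v≼x v≼¬x = ≼⊥⇒≈⊥ (≼-respʳ (∧-complementʳ x) (∧-greatest v≼x v≼¬x))

  ≼¬⇒∧≈⊥ : ∀ {x y} → x ≼ ¬ y → x ∧ y ≈ ⊥
  ≼¬⇒∧≈⊥ x≼¬y = contradictory (x∧y≼y _ _) (≼-trans (x∧y≼x _ _) x≼¬y)

  ∧≈⊥⇒≼¬ : ∀ {x y} → x ∧ y ≈ ⊥ → x ≼ ¬ y
  ∧≈⊥⇒≼¬ {x} {y} x∧y≈⊥ = begin
    x ∧ ¬ y            ≈⟨ ∨-identityˡ (x ∧ ¬ y) ⟨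
    ⊥ ∨ x ∧ ¬ y        ≈⟨ ∨-congʳ x∧y≈⊥ ⟨
    x ∧ y ∨ x ∧ ¬ y    ≈⟨ ∧-distribˡ-∨ x y (¬ y) ⟨
    x ∧ (y ∨ ¬ y)      ≈⟨ ∧-congˡ (∨-complementʳ y) ⟩
    x ∧ ⊤              ≈⟨ ∧-identityʳ x ⟩
    x                  ∎

  -- The primality of an ultrafilter: when `v` lies below `¬ x`, the summand `v ∧ x` of
  -- `v ∧ (x ∨ y)` vanishes.
  ∨-split : ∀ {v x y} → Decides v x → v ≼ x ∨ y → v ≼ x ⊎ v ≼ y
  ∨-split (inj₁ v≼x)  _ = inj₁ v≼x
  ∨-split {v} {x} {y} (inj₂ v≼¬x) v≼x∨y = inj₂ (begin
    v ∧ y              ≈⟨ ∨-identityˡ (v ∧ y) ⟨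
    ⊥ ∨ v ∧ y          ≈⟨ ∨-congʳ (≼¬⇒∧≈⊥ v≼¬x) ⟨
    v ∧ x ∨ v ∧ y      ≈⟨ ∧-distribˡ-∨ v x y ⟨
    v ∧ (x ∨ y)        ≈⟨ v≼x∨y ⟩
    v                  ∎)

  ≼-antisym : ∀ {x y} → x ≼ y → y ≼ x → x ≈ y
  ≼-antisym {x} {y} x≼y y≼x = ≈-trans (≈-sym x≼y) (≈-trans (∧-comm x y) y≼x)

  Disjoint : Carrier → Carrier → Set ℓ
  Disjoint x y = x ∧ y ≈ ⊥

  disjoint-sym : ∀ {x y} → Disjoint x y → Disjoint y x
  disjoint-sym = ≈-trans (∧-comm _ _)

  disjoint-≼ : ∀ {x x′ y y′} → x ≼ x′ → y ≼ y′ → Disjoint x′ y′ → Disjoint x y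
  disjoint-≼ x≼x′ y≼y′ d = ≼⊥⇒≈⊥ (≼-respʳ d (∧-mono x≼x′ y≼y′))

  decides-≼ : ∀ {u v x} → u ≼ v → Decides v x → Decides u x
  decides-≼ u≼v (inj₁ h) = inj₁ (≼-trans u≼v h)
  decides-≼ u≼v (inj₂ h) = inj₂ (≼-trans u≼v h)

  -- Being below `¬ x` would make `v` disjoint from `x`. This turns a mere intersection, such as an
  -- arrow provides, into an inclusion.
  decides-meets : ∀ {v x} → Decides v x → Not (Disjoint v x) → v ≼ x
  decides-meets (inj₁ v≼x)  _ = v≼x
  decides-meets (inj₂ v≼¬x) m = contradiction (≼¬⇒∧≈⊥ v≼¬x) m

  ⋁-disjoint : ∀ {n y} (p : Fin n → Carrier) → (∀ j → Disjoint (p j) y) → Disjoint (⋁ p) y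
  ⋁-disjoint {zero}          p d = ∧-zeroˡ _
  ⋁-disjoint {suc n} {y = y} p d = begin
    (p zero ∨ ⋁ (p ∘ suc)) ∧ y      ≈⟨ ∧-distribʳ-∨ y _ _ ⟩
    p zero ∧ y ∨ ⋁ (p ∘ suc) ∧ y    ≈⟨ ∨-cong (d zero) (⋁-disjoint (p ∘ suc) (d ∘ suc)) ⟩
    ⊥ ∨ ⊥                           ≈⟨ ∨-identityˡ ⊥ ⟩
    ⊥                               ∎

  join : List Carrier → Carrier
  join = foldr _∨_ ⊥

  join-++ : ∀ xs ys → join (xs ++ ys) ≈ join xs ∨ join ys
  join-++ []       ys = ≈-sym (∨-identityˡ _)
  join-++ (x ∷ xs) ys = ≈-trans (∨-congˡ (join-++ xs ys)) (≈-sym (∨-assoc _ _ _))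

  join-∧ : ∀ x ys → join (map (x ∧_) ys) ≈ x ∧ join ys
  join-∧ x []       = ≈-sym (∧-zeroʳ x)
  join-∧ x (y ∷ ys) = ≈-trans (∨-congˡ (join-∧ x ys)) (≈-sym (∧-distribˡ-∨ _ _ _))

  ⋁-lookup : ∀ xs → ⋁ (lookup xs) ≡ join xs
  ⋁-lookup []       = refl
  ⋁-lookup (x ∷ xs) = cong (x ∨_) (⋁-lookup xs)

  lookup-disjoint : ∀ {xs} → AllPairs Disjoint xs →
    ∀ i j → Not (i ≡ j) → Disjoint (lookup xs i) (lookup xs j)
  lookup-disjoint (ds ∷ _)  zero    zero    i≢j = contradiction refl i≢j
  lookup-disjoint (ds ∷ _)  zero    (suc j) _   = All.lookup ds (∈-lookup j)
  lookup-disjoint (ds ∷ _)  (suc i) zero    _   = disjoint-sym (All.lookup ds (∈-lookup i))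
  lookup-disjoint (_ ∷ dss) (suc i) (suc j) i≢j =
    lookup-disjoint dss i j (i≢j ∘ cong suc)

  -- The atoms of the subalgebra generated by xs, padded with copies of ⊥.
  minterms : List Carrier → List Carrier
  minterms []       = ⊤ ∷ []
  minterms (x ∷ xs) = map (x ∧_) (minterms xs) ++ map (¬ x ∧_) (minterms xs)

  minterms-join : ∀ xs → join (minterms xs) ≈ ⊤
  minterms-join []       = ∨-identityʳ ⊤
  minterms-join (x ∷ xs) = begin
    join (map (x ∧_) ms ++ map (¬ x ∧_) ms)       ≈⟨ join-++ (map (x ∧_) ms) _ ⟩
    join (map (x ∧_) ms) ∨ join (map (¬ x ∧_) ms) ≈⟨ ∨-cong (join-∧ x ms) (join-∧ (¬ x) ms) ⟩
    x ∧ join ms ∨ ¬ x ∧ join ms                   ≈⟨ ∧-distribʳ-∨ (join ms) x (¬ x) ⟨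
    (x ∨ ¬ x) ∧ join ms                           ≈⟨ ∧-cong (∨-complementʳ x) (minterms-join xs) ⟩
    ⊤ ∧ ⊤                                         ≈⟨ ∧-identityʳ ⊤ ⟩
    ⊤                                             ∎
    where ms = minterms xs

  minterms-disjoint : ∀ xs → AllPairs Disjoint (minterms xs)
  minterms-disjoint []       = [] ∷ []
  minterms-disjoint (x ∷ xs) = AllPairsₚ.++⁺ (within x) (within (¬ x))
    (Allₚ.map⁺ (All.universal (λ u → Allₚ.map⁺ (All.universal (λ v →
      disjoint-≼ (x∧y≼x x u) (x∧y≼x (¬ x) v) (∧-complementʳ x)) _)) _))
    where
    within : ∀ z → AllPairs Disjoint (map (z ∧_) (minterms xs))
    within z = AllPairsₚ.map⁺ (AllPairs.map (disjoint-≼ (x∧y≼y z _) (x∧y≼y z _)) (minterms-disjoint xs))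

  minterms-decide : ∀ xs → All (λ v → All (Decides v) xs) (minterms xs)
  minterms-decide []       = [] ∷ []
  minterms-decide (x ∷ xs) = Allₚ.++⁺
    (Allₚ.map⁺ (All.map (λ {v} ds → inj₁ (x∧y≼x x v) ∷ All.map (decides-≼ (x∧y≼y x v)) ds)
      (minterms-decide xs)))
    (Allₚ.map⁺ (All.map (λ {v} ds → inj₂ (x∧y≼x (¬ x) v) ∷ All.map (decides-≼ (x∧y≼y (¬ x) v)) ds)
      (minterms-decide xs)))

  module _ (em : ExcludedMiddle ℓ) where

    -- An element disjoint from every block is disjoint from their join `⊤`, hence is `⊥`.
    meets-some : ∀ {n y} (p : Fin n → Carrier) → ⋁ p ≈ ⊤ → Not (y ≈ ⊥) →
      ∃ λ j → Not (Disjoint (p j) y)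
    meets-some {y = y} p covers y≉⊥ = ¬∀⟶∃¬ _ _ (λ _ → em) λ d →
      y≉⊥ (≈-trans (≈-sym (∧-identityˡ y)) (≈-trans (∧-congʳ (≈-sym covers)) (⋁-disjoint p d)))

    nonzero? : ∀ x → Dec (Not (x ≈ ⊥))
    nonzero? _ = ¬? em

    join-filter : ∀ xs → join (filter nonzero? xs) ≈ join xs
    join-filter []       = ≈-refl
    join-filter (x ∷ xs) with em {x ≈ ⊥}
    ... | yes x≈⊥ = ≈-trans (join-filter xs) (≈-sym (≈-trans (∨-congʳ x≈⊥) (∨-identityˡ _)))
    ... | no  _   = ∨-congˡ (join-filter xs)

    -- Discarding the minterms equal to `⊥` leaves the join unchanged and makes the remaining ones a
    -- partition.
    deciding-partition : ∀ xs → ∃ λ n → Σ (Fin n → Carrier) λ p →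
      IsPartition (toRaw 𝔹) p × (∀ j → All (Decides (p j)) xs)
    deciding-partition xs = length ps , lookup ps , record
        { nonzero  = λ j → All.lookup (Allₚ.all-filter nonzero? (minterms xs)) (∈-lookup j)
        ; disjoint = lookup-disjoint (AllPairsₚ.filter⁺ nonzero? (minterms-disjoint xs))
        ; covers   = ≈-trans (reflexive (⋁-lookup ps))
                       (≈-trans (join-filter (minterms xs)) (minterms-join xs)) } ,
      λ j → All.lookup (Allₚ.filter⁺ nonzero? (minterms-decide xs)) (∈-lookup j)
      where ps = filter nonzero? (minterms xs)

-- Walks, their finite approximations, and splicing

module Walks {c ℓ} (em : ExcludedMiddle ℓ) (em₀ : ExcludedMiddle 0ℓ) (𝔹 : DynSys c ℓ)
  (e : ℕ → DynSys.Carrier 𝔹) (X : ℕ → ℕ → Bool) (y : ℕ → DynSys.Carrier 𝔹) where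

  open DynSys 𝔹 using (alg; aut; isAut; Carrier; _≈_; ⊥; _∧_; _∨_; ¬_) renaming (_≤_ to _≼_)
  open Order alg
  private module β = IsBoolHom (IsAutomorphism.hom isAut)

  aut-mono : ∀ {u v} → u ≼ v → aut u ≼ aut v
  aut-mono u≼v = BooleanAlgebra.trans alg (BooleanAlgebra.sym alg (β.∧-hom _ _)) (β.cong u≼v)

  -- `X i` and `y i` stand for the images under `η` and `ι` of the `i`-th element in an enumeration
  -- of 𝔸.
  record ValidAt (n : ℕ) (v : ℕ → Carrier) (k : ℕ) : Set ℓ where
    field
      nonzero : Not (v k ≈ ⊥)
      decides : ∀ i → i < n → Decides (v k) (e i)
      step    : ∀ i → i < n → v k ≼ e i → v (suc k) ≼ aut (e i)
      tracks  : ∀ i → i < n → X i k ≡ true → v k ≼ y i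

  record Approximation (n : ℕ) (v : ℕ → Carrier) : Set ℓ where
    field
      valid  : Eventually (ValidAt n v)
      visits : ∀ i → i < n → Not (e i ≈ ⊥) → InfinitelyOften (λ k → v k ≼ e i)

  -- `step` and `tracks` are one-sided implications: their converses come from the same clauses
  -- applied to complements.
  record Generic (w : ℕ → Carrier) : Set (c ⊔ ℓ) where
    field
      nonzero : Eventually (λ k → Not (w k ≈ ⊥))
      decides : ∀ x → Eventually (λ k → Decides (w k) x)
      step    : ∀ x → Eventually (λ k → w k ≼ x → w (suc k) ≼ aut x)
      tracks  : ∀ i → Eventually (λ k → X i k ≡ true → w k ≼ y i)
      visits  : ∀ x → Not (x ≈ ⊥) → InfinitelyOften (λ k → w k ≼ x)

  weaken : ∀ {m n v} → m ≤ n → Approximation n v → Approximation m v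
  weaken m≤n a = record
    { valid  = ev-map (λ _ h → let open ValidAt h in record
        { nonzero = nonzero
        ; decides = λ i lt → decides i (<-≤-trans lt m≤n)
        ; step    = λ i lt → step i (<-≤-trans lt m≤n)
        ; tracks  = λ i lt → tracks i (<-≤-trans lt m≤n) }) valid
    ; visits = λ i lt → visits i (<-≤-trans lt m≤n) }
    where open Approximation a

  does-transfer : ∀ {a} {P Q : Set a} (P? : Dec P) (Q? : Dec Q) → does P? ≡ does Q? → P → Q
  does-transfer _         (yes q) _  _ = q
  does-transfer (yes _)   (no _)  () _
  does-transfer (no ¬p)   _       _  p = contradiction p ¬p

  module Splice
    (u : ℕ → ℕ → Carrier)
    (approx : ∀ m → Approximation m (u m))
    (agree : ∀ m → InfinitelyOften (λ k → ∀ i → i < m → u m k ≼ e i → u (suc m) k ≼ e i))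
    where

    private module U m = Approximation (approx m)

    VisitedBetween : ℕ → ℕ → ℕ → ℕ → Set ℓ
    VisitedBetween m lo hi i = ∃ λ k → lo ≤ k × k < hi × u m k ≼ e i

    -- `hi` is the time of passing from `u m` to `u (suc m)`: `visited` secures the visits due
    -- before leaving, `agrees` keeps the step across the switch correct, and `settled` makes the
    -- new walk valid from `hi` on.
    record Switch (m lo hi : ℕ) : Set ℓ where
      field
        later   : lo < hi
        agrees  : ∀ i → i < m → u m hi ≼ e i → u (suc m) hi ≼ e i
        visited : ∀ i → i < m → Not (e i ≈ ⊥) → VisitedBetween m lo hi i
        settled : proj₁ (U.valid (suc m)) ≤ hi

    next : ∀ m lo → ∃ (Switch m lo)
    -- Agreement recurs and the other demands hold from some time on, so all of them meet at one
    -- time; searching from `suc lo` makes it later than `lo`.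
    next m lo = conclude (io-ev (agree m)
      (ev-∩ (ev-below m {λ i hi → Not (e i ≈ ⊥) → VisitedBetween m lo hi i} visit)
            (ev-≥ (proj₁ (U.valid (suc m))))) (suc lo))
      where
      visit : ∀ i → i < m → Eventually (λ hi → Not (e i ≈ ⊥) → VisitedBetween m lo hi i)
      visit i i<m = ev-if (¬? em) λ nz → let k , lo≤k , h = U.visits m i i<m nz lo in
        suc k , λ hi k<hi → k , lo≤k , k<hi , h

      conclude : (∃ λ hi → lo < hi × (∀ i → i < m → u m hi ≼ e i → u (suc m) hi ≼ e i) ×
        (∀ i → i < m → Not (e i ≈ ⊥) → VisitedBetween m lo hi i) ×
        proj₁ (U.valid (suc m)) ≤ hi) → ∃ (Switch m lo)
      conclude (hi , lo<hi , ag , vis , T≤) =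
        hi , record { later = lo<hi ; agrees = ag ; visited = vis ; settled = T≤ }

    K : ℕ → ℕ
    K zero    = 0
    K (suc m) = proj₁ (next m (K m))

    private module S m = Switch (proj₂ (next m (K m)))

    K-increasing : ∀ m → K m < K (suc m)
    K-increasing m = S.later m

    K-mono : ∀ {m n} → m ≤ n → K m ≤ K n
    K-mono {m} {zero}  z≤n = ≤-refl
    K-mono {m} {suc n} m≤1+n with m≤n⇒m<n∨m≡n m≤1+n
    ... | inj₁ (s≤s m≤n) = ≤-trans (K-mono m≤n) (<⇒≤ (K-increasing n))
    ... | inj₂ refl      = ≤-refl

    in-level : ∀ k → ∃ λ m → K m ≤ k × k < K (suc m)
    in-level = levels K refl K-increasing

    level : ℕ → ℕ
    level k = proj₁ (in-level k)

    level-≥ : ∀ {m k} → K m ≤ k → m ≤ level k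
    level-≥ {m} {k} Km≤k with m ≤? level k
    ... | yes le = le
    ... | no gt  = contradiction (<-≤-trans (proj₂ (proj₂ (in-level k))) (K-mono (≰⇒> gt)))
                                 (≤⇒≯ Km≤k)

    level-unique : ∀ {m k} → K m ≤ k → k < K (suc m) → level k ≡ m
    level-unique {m} {k} Km≤k k<K with level k ≤? m
    ... | yes le = ≤-antisym le (level-≥ Km≤k)
    ... | no gt  = contradiction (<-≤-trans k<K (≤-trans (K-mono (≰⇒> gt)) (proj₁ (proj₂ (in-level k)))))
                                 (<-irrefl refl)

    w : ℕ → Carrier
    w k = u (level k) k

    -- The interval before `K 1` is excluded because `K 0` is not chosen by a switch, so `u 0` may
    -- not have settled there.
    valid-at : ∀ {k} → K 1 ≤ k → ValidAt (level k) (u (level k)) k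
    valid-at {k} K1≤k = from (level k) (level-≥ K1≤k) (proj₁ (proj₂ (in-level k)))
      where
      from : ∀ m → 1 ≤ m → K m ≤ k → ValidAt m (u m) k
      from (suc m) _ Km≤k = proj₂ (U.valid (suc m)) k (≤-trans (S.settled m) Km≤k)

    below-w : ∀ {m k x} → K m ≤ k → k < K (suc m) → u m k ≼ x → w k ≼ x
    below-w {k = k} {x} Km≤k k<K = subst (λ m → u m k ≼ x) (sym (level-unique Km≤k k<K))

    -- If `suc k` is the switching time, `w (suc k)` is already taken from `u (suc m)`, and the
    -- agreement at that time carries the bound over.
    follows : ∀ {m k i} → K m ≤ k → k < K (suc m) → i < m → u m (suc k) ≼ e i → w (suc k) ≼ e i
    follows {m} {k} {i} Km≤k k<K i<m h with m≤n⇒m<n∨m≡n k<K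
    ... | inj₁ 1+k<K = below-w (m≤n⇒m≤1+n Km≤k) 1+k<K h
    ... | inj₂ 1+k≡K = subst (λ j → w j ≼ e i) (sym 1+k≡K)
      (below-w ≤-refl (K-increasing (suc m))
        (S.agrees m i i<m (subst (λ j → u m j ≼ e i) 1+k≡K h)))

    at-level : ∀ n → Eventually (λ k → n < level k × ValidAt (level k) (u (level k)) k)
    at-level n = K (suc n) , λ k le → level-≥ le , valid-at (≤-trans (K-mono (s≤s z≤n)) le)

    w-generic : (∀ x → ∃ λ i → e i ≈ x) → Generic w
    w-generic e-surj = record
      { nonzero = ev-map (λ k h → ValidAt.nonzero (proj₂ h)) (at-level 0)
      ; decides = λ x → let i , ei≈x = e-surj x in
          ev-map (λ k h → decides-resp ei≈x (ValidAt.decides (proj₂ h) i (proj₁ h))) (at-level i)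
      ; step    = w-step
      ; tracks  = λ i → ev-map (λ k h → ValidAt.tracks (proj₂ h) i (proj₁ h)) (at-level i)
      ; visits  = w-visits }
      where
      open BooleanAlgebra alg using (¬-cong) renaming (sym to ≈-sym)

      decides-resp : ∀ {v x x′} → x ≈ x′ → Decides v x → Decides v x′
      decides-resp eq (inj₁ h) = inj₁ (≼-respʳ eq h)
      decides-resp eq (inj₂ h) = inj₂ (≼-respʳ (¬-cong eq) h)

      w-step : ∀ x → Eventually (λ k → w k ≼ x → w (suc k) ≼ aut x)
      -- The level must exceed the index of `aut x` as well as that of `x`: a switch carries over
      -- only bounds by elements with index below the level.
      w-step x with e-surj x | e-surj (aut x)
      ... | i , ei≈x | j , ej≈βx = ev-map
        (λ { k ((i< , h) , (j< , _)) wk≼x →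
          ≼-respʳ ej≈βx (follows (proj₁ (proj₂ (in-level k))) (proj₂ (proj₂ (in-level k))) j< (≼-respʳ (≈-sym ej≈βx)
            (≼-respʳ (β.cong ei≈x) (ValidAt.step h i i< (≼-respʳ (≈-sym ei≈x) wk≼x))))) })
        (ev-∩ (at-level i) (at-level j))

      w-visits : ∀ x → Not (x ≈ ⊥) → InfinitelyOften (λ k → w k ≼ x)
      w-visits x x≉⊥ N with e-surj x
      ... | i , ei≈x with in-level N
      ... | m₀ , _ , N<K
        -- This level exceeds `i`, so a visit to `e i` is due there; it also exceeds the level `m₀`
        -- of `N`, so the visit comes after `N`.
        with S.visited (suc (max m₀ i)) i (s≤s (m≤n⊔m m₀ i))
               (λ z → x≉⊥ (BooleanAlgebra.trans alg (≈-sym ei≈x) z))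
      ... | k , K≤k , k<K , h =
        k , ≤-trans (<⇒≤ N<K) (≤-trans (K-mono (s≤s (m≤m⊔n m₀ i))) K≤k) ,
        below-w K≤k k<K (≼-respʳ ei≈x h)

  generic-walk : (∀ x → ∃ λ i → e i ≈ x) →
    (∀ n → ∃ (Approximation n)) → ∃ Generic
  -- The bits record whether the `n`-th approximation at time `k` lies below `e i`.
  generic-walk e-surj approx with recurrent-agreement em₀ (λ n k i → does (em {proj₁ (approx n) k ≼ e i}))
  ... | ν , m≤ν , agree = w , w-generic e-surj
    where
    open Splice (λ m → proj₁ (approx (ν m)))
      (λ m → weaken (m≤ν m) (proj₂ (approx (ν m))))
      (λ m → io-map (λ k h i i<m → does-transfer em em (h i i<m)) (agree m))

-- P(ω)/Fin

private module P = RawBA PωFin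

infix 4 _≐_

-- P._≈_ with the xor eliminated: unlike xor, ≡ lets U and V be inferred.
_≐_ : (U V : ℕ → Bool) → Set
U ≐ V = Eventually (λ n → U n ≡ V n)

≈⇒≐ : ∀ U V → U P.≈ V → U ≐ V
≈⇒≐ U V = ev-map λ n → xor-false (U n) (V n)
  where
  xor-false : ∀ x y → x xor y ≡ false → x ≡ y
  xor-false false false _ = refl
  xor-false true  true  _ = refl

≐⇒≈ : ∀ U V → U ≐ V → U P.≈ V
≐⇒≈ U V = ev-map λ n eq → trans (cong (_xor V n) eq) (xor-same (V n))

≐-sym : ∀ {U V} → U ≐ V → V ≐ U
≐-sym = ev-map (λ _ → sym)

≐-trans : ∀ {U V W} → U ≐ V → V ≐ W → U ≐ W
≐-trans U≐V V≐W = ev-map (λ _ h → trans (proj₁ h) (proj₂ h)) (ev-∩ U≐V V≐W)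

≤⇒ev : ∀ U V → U P.≤ V → Eventually (λ n → U n ≡ true → V n ≡ true)
≤⇒ev U V U≤V = ev-map
  (λ n eq Un → trans (cong (Bool._∧ V n) (sym Un)) (trans eq Un)) (≈⇒≐ (U P.∧ V) U U≤V)

ev⇒≤ : ∀ U V → Eventually (λ n → U n ≡ true → V n ≡ true) → U P.≤ V
ev⇒≤ U V ev = ≐⇒≈ (U P.∧ V) U (ev-map (λ n → absorb (U n) (V n)) ev)
  where
  absorb : ∀ x y → (x ≡ true → y ≡ true) → x Bool.∧ y ≡ x
  absorb false y h = refl
  absorb true  y h = h refl

∧≈⊥⇒ev : ∀ U V → U P.∧ V ≐ P.⊥ → Eventually (λ n → U n ≡ true → Not (V n ≡ true))
∧≈⊥⇒ev U V = ev-map (λ _ eq Un Vn → contradiction (trans (sym eq) (cong₂ Bool._∧_ Un Vn)) λ ())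

⋁-true : ∀ {n} (U : Fin n → ℕ → Bool) k → P.⋁ U k ≡ true → ∃ λ j → U j k ≡ true
⋁-true {suc n} U k eq with U zero k in U₀
... | true  = zero , U₀
... | false with ⋁-true (U ∘ suc) k eq
...   | j , Uj = suc j , Uj

⋁-hom : ∀ {c ℓ c′ ℓ′} (R : RawBA c ℓ) (𝔹 : BooleanAlgebra c′ ℓ′)
  {f : RawBA.Carrier R → BooleanAlgebra.Carrier 𝔹} → IsBoolHom R (toRaw 𝔹) f →
  ∀ {n} (p : Fin n → RawBA.Carrier R) →
  BooleanAlgebra._≈_ 𝔹 (f (RawBA.⋁ R p)) (RawBA.⋁ (toRaw 𝔹) (f ∘ p))
⋁-hom R 𝔹 hom {zero}  p = IsBoolHom.⊥-hom hom
⋁-hom R 𝔹 hom {suc n} p = BooleanAlgebra.trans 𝔹 (IsBoolHom.∨-hom hom _ _)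
  (BooleanAlgebra.∨-congˡ 𝔹 (⋁-hom R 𝔹 hom (p ∘ suc)))

module Image {c ℓ} (𝔸 : BooleanAlgebra c ℓ) (f : BooleanAlgebra.Carrier 𝔸 → ℕ → Bool)
  (hom : IsBoolHom (toRaw 𝔸) PωFin f) where

  open Order 𝔸
  open RawBA (toRaw 𝔸) renaming (_≤_ to _≼_)
  private module f = IsBoolHom hom

  image-cong : ∀ {x y} → x ≈ y → f x ≐ f y
  image-cong x≈y = ≈⇒≐ _ _ (f.cong x≈y)

  image-∧ : ∀ x y → f (x ∧ y) ≐ f x P.∧ f y
  image-∧ x y = ≈⇒≐ _ _ (f.∧-hom x y)

  image-¬ : ∀ x → f (¬ x) ≐ P.¬ f x
  image-¬ x = ≈⇒≐ _ _ (f.¬-hom x)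

  image-⊤ : f ⊤ ≐ P.⊤
  image-⊤ = ≈⇒≐ _ _ f.⊤-hom

  image-⊥ : f ⊥ ≐ P.⊥
  image-⊥ = ≈⇒≐ _ _ f.⊥-hom

  image-⋁ : ∀ {n} (p : Fin n → Carrier) → f (⋁ p) ≐ P.⋁ (f ∘ p)
  image-⋁ {zero}  p = image-⊥
  image-⋁ {suc n} p = ≐-trans (≈⇒≐ _ _ (f.∨-hom _ _))
    (ev-map (λ k → cong (f (p zero) k Bool.∨_)) (image-⋁ (p ∘ suc)))

  image-disjoint : ∀ {x y} → Disjoint x y → Eventually (λ k → f x k ≡ true → Not (f y k ≡ true))
  image-disjoint {x} {y} d = ∧≈⊥⇒ev (f x) (f y)
    (≐-trans (≐-sym (image-∧ x y)) (≐-trans (image-cong d) image-⊥))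

  image-mono : ∀ {x y} → x ≼ y → Eventually (λ k → f x k ≡ true → f y k ≡ true)
  image-mono {x} {y} x≼y = ≤⇒ev (f x) (f y)
    (≐⇒≈ _ _ (≐-trans (≐-sym (image-∧ x y)) (image-cong x≼y)))

module _ {c ℓ} (em : ExcludedMiddle ℓ) (em₀ : ExcludedMiddle 0ℓ) (𝔸 𝔹 : DynSys c ℓ)
  (ι : DynSys.Carrier 𝔸 → DynSys.Carrier 𝔹)
  (ι-emb : IsEmbedding (DynSys.raw 𝔸) (DynSys.raw 𝔹) (DynSys.aut 𝔸) (DynSys.aut 𝔹) ι)
  (η : DynSys.Carrier 𝔸 → ℕ → Bool)
  (η-emb : IsEmbedding (DynSys.raw 𝔸) PωFin (DynSys.aut 𝔸) σ η)
  where

  private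
    module A where
      open DynSys 𝔸 public renaming (_≤_ to _≼_)
      open Order alg public
    module B where
      open DynSys 𝔹 public renaming (_≤_ to _≼_)
      open BooleanAlgebra alg public using (¬-cong)
        renaming (sym to ≈-sym; trans to ≈-trans)
      open Order alg public
    module ι = IsBoolHom (IsEmbedding.hom ι-emb)
    module η = Image A.alg η (IsEmbedding.hom η-emb)
    module β = IsBoolHom (IsAutomorphism.hom B.isAut)

  Extension : (B.Carrier → ℕ → Bool) → Set (c ⊔ ℓ)
  Extension η̄ = IsEmbedding B.raw PωFin B.aut σ η̄ × (∀ a → η̄ (ι a) P.≈ η a)

  ι-mono : ∀ {x y} → x A.≼ y → ι x B.≼ ι y
  ι-mono x≼y = B.≈-trans (B.≈-sym (ι.∧-hom _ _)) (ι.cong x≼y)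

  ι-covers : ∀ {k} {𝒜 : Fin k → A.Carrier} → IsPartition A.raw 𝒜 → B.⋁ (ι ∘ 𝒜) B.≈ B.⊤
  ι-covers {𝒜 = 𝒜} 𝒜-part = B.≈-trans
    (B.≈-sym (⋁-hom A.raw B.alg (IsEmbedding.hom ι-emb) 𝒜))
    (B.≈-trans (ι.cong (IsPartition.covers 𝒜-part)) ι.⊤-hom)

  -- From an extension to the condition (†)

  extension⇒dagger : ∃ Extension → Dagger 𝔸 𝔹 ι η
  extension⇒dagger (η̄ , emb , extends) {k} {m} 𝒜 ℬ 𝒜-part ℬ-part refines =
    -- Arrows correspond both ways: by injectivity of `η̄`, the meet of `σ (η̄ (ℬ i))` and
    -- `η̄ (ℬ j)` is finite exactly when that of `aut (ℬ i)` and `ℬ j` is `⊥`.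
    m , η̄ ∘ ℬ , partition , refines′ , ↔-id _ ,
    (λ i j → (λ arrow z → arrow (reflects-⊥ (≐-trans (arrow-image i j) (≈⇒≐ _ _ z)))) ,
             (λ arrow z → arrow (≐⇒≈ _ _ (≐-trans (≐-sym (arrow-image i j)) (preserves-⊥ z))))) ,
    λ i → (λ j → below i j) , least i
    where
    open IsEmbedding emb
    open Image B.alg η̄ hom
    module 𝒜 = IsPartition 𝒜-part
    module ℬ = IsPartition ℬ-part

    reflects-⊥ : ∀ {x} → η̄ x ≐ P.⊥ → x B.≈ B.⊥
    reflects-⊥ z = injective (≐⇒≈ _ _ (≐-trans z (≐-sym image-⊥)))

    preserves-⊥ : ∀ {x} → x B.≈ B.⊥ → η̄ x ≐ P.⊥
    preserves-⊥ z = ≐-trans (image-cong z) image-⊥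

    arrow-image : ∀ i j → η̄ (B.aut (ℬ i) B.∧ ℬ j) ≐ σ (η̄ (ℬ i)) P.∧ η̄ (ℬ j)
    arrow-image i j = ≐-trans (image-∧ _ _)
      (ev-map (λ k → cong (Bool._∧ η̄ (ℬ j) k)) (≈⇒≐ _ (σ (η̄ (ℬ i))) (commutes _)))

    partition : IsPartition PωFin (η̄ ∘ ℬ)
    partition = record
      { nonzero  = λ i z → ℬ.nonzero i (reflects-⊥ (≈⇒≐ _ _ z))
      ; disjoint = λ i j i≢j → ≐⇒≈ _ _ (≐-trans (≐-sym (image-∧ _ _)) (preserves-⊥ (ℬ.disjoint i j i≢j)))
      ; covers   = ≐⇒≈ _ _ (≐-trans (≐-sym (image-⋁ ℬ)) (≐-trans (image-cong ℬ.covers) image-⊤)) }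

    below : ∀ i j → ℬ j B.≼ ι (𝒜 i) → η̄ (ℬ j) P.≤ η (𝒜 i)
    below i j h = ev⇒≤ (η̄ (ℬ j)) (η (𝒜 i)) (ev-map
      (λ { k (imp , eq) x → trans (sym eq) (imp x) })
      (ev-∩ (image-mono h) (≈⇒≐ _ _ (extends (𝒜 i)))))

    refines′ : Refines PωFin (η̄ ∘ ℬ) (η ∘ 𝒜)
    refines′ j = let i , h = refines j in i , below i j h

    least : ∀ i u → (∀ j → ℬ j B.≼ ι (𝒜 i) → η̄ (ℬ j) P.≤ u) → η (𝒜 i) P.≤ u
    least i u bound = ev⇒≤ (η (𝒜 i)) u (ev-map
      (λ k h η𝒜 → let cov , eq , imp = h
                      j , ℬj = ⋁-true (η̄ ∘ ℬ) k cov
                  in imp j (trans eq η𝒜) ℬj)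
      (ev-∩ (≈⇒≐ _ _ (IsPartition.covers partition))
        (ev-∩ (≈⇒≐ _ _ (extends (𝒜 i))) (ev-fin block))))
      where
      -- A late point of `η (𝒜 i)` lies in some image block. A block below another `ι (𝒜 l)` has
      -- image almost disjoint from `η̄ (ι (𝒜 i))`, so only blocks bounded by `u` remain.
      block : ∀ j → Eventually (λ k → η̄ (ι (𝒜 i)) k ≡ true → η̄ (ℬ j) k ≡ true → u k ≡ true)
      block j with refines j
      ... | l , ℬj≼ with i ≟ᶠ l
      ...   | yes refl = ev-map (λ _ h _ → h) (≤⇒ev (η̄ (ℬ j)) u (bound j ℬj≼))
      ...   | no i≢l   = ev-map (λ _ h x y → contradiction y (h x)) (image-disjoint
        (B.disjoint-≼ B.≼-refl ℬj≼
          (B.≈-trans (B.≈-sym (ι.∧-hom _ _)) (B.≈-trans (ι.cong (𝒜.disjoint i l i≢l)) ι.⊥-hom))))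

  ι-≼¬ : ∀ {v x} → v B.≼ ι (A.¬ x) → v B.≼ B.¬ ι x
  ι-≼¬ = B.≼-respʳ (ι.¬-hom _)

  -- From (†) to finite approximations of a walk

  module DaggerWalk (dagger : Dagger 𝔸 𝔹 ι η) {k m n : ℕ}
    (a : ℕ → A.Carrier) (e : ℕ → B.Carrier)
    {𝒜 : Fin k → A.Carrier} (𝒜-part : IsPartition A.raw 𝒜)
    (𝒜-decides : ∀ l i → i < n → A.Decides (𝒜 l) (a i))
    {ℬ : Fin m → B.Carrier} (ℬ-part : IsPartition B.raw ℬ)
    (ℬ-decides : ∀ j i → i < n → B.Decides (ℬ j) (e i))
    (ℬ-decides-aut : ∀ j i → i < n → B.Decides (ℬ j) (B.aut (e i)))
    (refines : Refines B.raw ℬ (ι ∘ 𝒜))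
    where

    open Walks em em₀ 𝔹 e (η ∘ a) (ι ∘ a)

    private
      lift-data = dagger 𝒜 ℬ 𝒜-part ℬ-part refines
      𝒞 = proj₁ (proj₂ lift-data)
      module 𝒞 = IsPartition (proj₁ (proj₂ (proj₂ lift-data)))
      module ℬ = IsPartition ℬ-part
      π = proj₁ (proj₂ (proj₂ (proj₂ (proj₂ lift-data))))
      open Inverse π using (to; from; strictlyInverseˡ; strictlyInverseʳ)
      arrows = proj₁ (proj₂ (proj₂ (proj₂ (proj₂ (proj₂ lift-data)))))
      joins  = proj₂ (proj₂ (proj₂ (proj₂ (proj₂ (proj₂ lift-data)))))

    η̃ : Fin m → ℕ → Bool
    η̃ j = 𝒞 (to j)

    to-injective : ∀ {i j} → to i ≡ to j → i ≡ j
    to-injective {i} {j} eq =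
      trans (sym (strictlyInverseʳ i)) (trans (cong from eq) (strictlyInverseʳ j))

    covered : Eventually (λ t → ∃ λ j → η̃ j t ≡ true)
    covered = ev-map located (≈⇒≐ _ _ 𝒞.covers)
      where
      located : ∀ t → P.⋁ 𝒞 t ≡ true → ∃ λ j → η̃ j t ≡ true
      located t eq with ⋁-true 𝒞 t eq
      ... | r , 𝒞r = from r , subst (λ r → 𝒞 r t ≡ true) (sym (strictlyInverseˡ r)) 𝒞r

    separated : Eventually (λ t → ∀ i j → η̃ i t ≡ true → η̃ j t ≡ true → i ≡ j)
    separated = ev-fin λ i → ev-fin λ j → pair i j
      where
      pair : ∀ i j → Eventually (λ t → η̃ i t ≡ true → η̃ j t ≡ true → i ≡ j)
      pair i j with i ≟ᶠ j
      ... | yes i≡j = ev-always λ _ _ _ → i≡j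
      ... | no i≢j  = ev-map (λ _ h x y → contradiction y (h x))
        (∧≈⊥⇒ev (η̃ i) (η̃ j) (≈⇒≐ _ _ (𝒞.disjoint _ _ (i≢j ∘ to-injective))))

    adjacent : Eventually (λ t → ∀ i j → η̃ i t ≡ true → η̃ j (suc t) ≡ true →
      Arrow B.raw B.aut (ℬ i) (ℬ j))
    adjacent = ev-fin λ i → ev-fin λ j → pair i j
      where
      pair : ∀ i j → Eventually (λ t → η̃ i t ≡ true → η̃ j (suc t) ≡ true → Arrow B.raw B.aut (ℬ i) (ℬ j))
      pair i j with em₀ {σ (η̃ i) P.∧ η̃ j P.≈ P.⊥}
      ... | yes z = ev-map (λ _ h x y → contradiction y (h x))
        -- `σ (η̃ i)` at `suc t` is `η̃ i` at `t`, so a finite meet with `η̃ j` eventually rules out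
        -- moving from block `i` to block `j`.
        (ev-suc (∧≈⊥⇒ev (σ (η̃ i)) (η̃ j) (≈⇒≐ _ _ z)))
      ... | no ¬z = ev-always λ _ _ _ → proj₂ (arrows i j) ¬z

    block-tracks : Eventually (λ t → ∀ j l → ℬ j B.≼ ι (𝒜 l) → η̃ j t ≡ true → η (𝒜 l) t ≡ true)
    block-tracks = ev-fin λ j → ev-fin λ l →
      ev-if em λ ℬj≼ → ≤⇒ev (η̃ j) (η (𝒜 l)) (proj₁ (joins l) j ℬj≼)

    -- If `𝒜 l` were below the complement of `a i`, their images would be almost disjoint. Together
    -- with `block-tracks` this yields the `tracks` clause.
    atom-tracks : Eventually (λ t → ∀ i → i < n → ∀ l →
      η (𝒜 l) t ≡ true → η (a i) t ≡ true → 𝒜 l A.≼ a i)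
    atom-tracks = ev-below n λ i i<n → ev-fin λ l → atom i i<n l
      where
      atom : ∀ i → i < n → ∀ l → Eventually (λ t → η (𝒜 l) t ≡ true → η (a i) t ≡ true → 𝒜 l A.≼ a i)
      atom i i<n l with 𝒜-decides l i i<n
      ... | inj₁ ≼ai  = ev-always λ _ _ _ → ≼ai
      ... | inj₂ ≼¬ai = ev-map (λ _ h x y → contradiction y (h x)) (η.image-disjoint (A.≼¬⇒∧≈⊥ ≼¬ai))

    located? : ∀ t → Dec (∃ λ j → η̃ j t ≡ true)
    located? t = any? (λ j → η̃ j t Bool.≟ true)

    block-of : ∀ {t} → Dec (∃ λ j → η̃ j t ≡ true) → B.Carrier
    block-of (yes (j , _)) = ℬ j
    -- A default value: `covered` confines this case to finitely many times.
    block-of (no _)        = B.⊥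

    v : ℕ → B.Carrier
    v t = block-of (located? t)

    InBlock : ℕ → Set c
    InBlock t = ∃ λ j → v t ≡ ℬ j × η̃ j t ≡ true

    in-block : Eventually InBlock
    in-block = ev-map (λ t → find t (located? t) refl) covered
      where
      find : ∀ t d → block-of d ≡ v t → (∃ λ j → η̃ j t ≡ true) → InBlock t
      find t (yes (j , h)) eq _ = j , sym eq , h
      find t (no ¬h)       _  h = contradiction h ¬h

    valid : Eventually (ValidAt n v)
    valid = ev-map conclude
      (ev-∩ in-block (ev-∩ (ev-suc in-block) (ev-∩ adjacent (ev-∩ block-tracks atom-tracks))))
      where
      conclude : ∀ t → InBlock t × InBlock (suc t) × _ × _ × _ → ValidAt n v t
      conclude t ((j , v≡ , η̃j) , (j′ , v′≡ , η̃j′) , arrow , block , atom) = record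
        { nonzero = λ z → ℬ.nonzero j (subst (B._≈ B.⊥) v≡ z)
        ; decides = λ i i<n → subst (λ x → B.Decides x (e i)) (sym v≡) (ℬ-decides j i i<n)
        -- The arrow makes `ℬ j′` meet `aut (ℬ j)`, hence `aut (e i)`; since `ℬ j′` decides
        -- `aut (e i)`, it lies below it.
        ; step    = λ i i<n v≼ → subst (B._≼ B.aut (e i)) (sym v′≡)
            (B.decides-meets (ℬ-decides-aut j′ i i<n) λ d → arrow j j′ η̃j η̃j′
              (B.disjoint-sym (B.disjoint-≼ B.≼-refl (aut-mono (subst (B._≼ e i) v≡ v≼)) d)))
        ; tracks  = λ i i<n ηai → let l , ℬj≼ = refines j in
            subst (B._≼ ι (a i)) (sym v≡)
              (B.≼-trans ℬj≼ (ι-mono (atom i i<n l (block j l ℬj≼ η̃j) ηai))) }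

    -- Some block meets `e i`, hence lies below it. Its image is infinite, being nonzero modulo
    -- finite sets, and late points of that image lie in no other image block.
    visits : ∀ i → i < n → Not (e i B.≈ B.⊥) → InfinitelyOften (λ t → v t B.≼ e i)
    visits i i<n ei≉⊥ with B.meets-some em ℬ ℬ.covers ei≉⊥
    ... | j , meets = io-map conclude (io-ev η̃j-infinite (ev-∩ in-block separated))
      where
      η̃j-infinite : InfinitelyOften (λ t → η̃ j t ≡ true)
      η̃j-infinite = ¬ev-¬⇒io em₀ λ ev → 𝒞.nonzero (to j) (≐⇒≈ _ _ (ev-map (λ _ → ¬-not) ev))

      conclude : ∀ t → η̃ j t ≡ true × InBlock t × (∀ i j → η̃ i t ≡ true → η̃ j t ≡ true → i ≡ j) → v t B.≼ e i
      conclude t (η̃j , (j′ , v≡ , η̃j′) , sep) with sep j j′ η̃j η̃j′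
      ... | refl = subst (B._≼ e i) (sym v≡) (B.decides-meets (ℬ-decides j i i<n) meets)

    approximation : ∃ (Approximation n)
    approximation = v , record { valid = valid ; visits = visits }

  dagger⇒approximation : Dagger 𝔸 𝔹 ι η → (a : ℕ → A.Carrier) (e : ℕ → B.Carrier) →
    ∀ n → ∃ (Walks.Approximation em em₀ 𝔹 e (η ∘ a) (ι ∘ a) n)
  dagger⇒approximation dagger a e n with A.deciding-partition em (applyUpTo a n)
  ... | k , 𝒜 , 𝒜-part , 𝒜-decides
    -- Deciding every `ι (𝒜 l)` makes `ℬ` refine the image of `𝒜`; deciding `e i` and `aut (e i)`
    -- serves the `decides` and `step` clauses.
    with B.deciding-partition em (tabulate (ι ∘ 𝒜) ++ applyUpTo e n ++ applyUpTo (B.aut ∘ e) n)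
  ... | m , ℬ , ℬ-part , ℬ-decides = DaggerWalk.approximation dagger a e 𝒜-part
      (λ l i i<n → Allₚ.applyUpTo⁻ a n (𝒜-decides l) i<n) ℬ-part
      (λ j i i<n → Allₚ.applyUpTo⁻ e n (Allₚ.++⁻ˡ _ (decided j)) i<n)
      (λ j i i<n → Allₚ.applyUpTo⁻ (B.aut ∘ e) n (Allₚ.++⁻ʳ (applyUpTo e n) (decided j)) i<n)
      refines
    where
    decided : ∀ j → All (B.Decides (ℬ j)) (applyUpTo e n ++ applyUpTo (B.aut ∘ e) n)
    decided j = Allₚ.++⁻ʳ (tabulate (ι ∘ 𝒜)) (ℬ-decides j)

    refines : Refines B.raw ℬ (ι ∘ 𝒜)
    refines j with B.meets-some em (ι ∘ 𝒜) (ι-covers 𝒜-part) (IsPartition.nonzero ℬ-part j)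
    ... | l , meets = l , B.decides-meets
      (Allₚ.tabulate⁻ (Allₚ.++⁻ˡ (tabulate (ι ∘ 𝒜)) (ℬ-decides j)) l) (meets ∘ B.disjoint-sym)

  -- From a generic walk to an extension

  module GenericExtension (a : ℕ → A.Carrier) (a-surj : ∀ x → ∃ λ i → a i A.≈ x) (e : ℕ → B.Carrier)
    {w : ℕ → B.Carrier} (generic : Walks.Generic em em₀ 𝔹 e (η ∘ a) (ι ∘ a) w) where

    open Walks.Generic generic

    η̄ : B.Carrier → ℕ → Bool
    η̄ x k = does (em {w k B.≼ x})

    η̄-true : ∀ {x k} → η̄ x k ≡ true → w k B.≼ x
    η̄-true {x} {k} eq with em {w k B.≼ x}
    ... | yes h = h
    η̄-true () | no _

    η̄-≐ : ∀ {x y} → Eventually (λ k → (w k B.≼ x → w k B.≼ y) × (w k B.≼ y → w k B.≼ x)) → η̄ x ≐ η̄ y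
    η̄-≐ = ev-map λ k h → does-⇔ (mk⇔ (proj₁ h) (proj₂ h)) em em

    -- If `x ∧ ¬ y` were nonzero, the walk would visit it infinitely often, with values below `x`
    -- and `¬ y` that are eventually nonzero, against the hypothesis.
    reflects-≼ : ∀ {x y} → Eventually (λ k → w k B.≼ x → w k B.≼ y) → x B.≼ y
    reflects-≼ {x} {y} imp with em {B.Disjoint x (B.¬ y)}
    ... | yes d = B.≼-respʳ (BAProperties.¬-involutive B.alg y) (B.∧≈⊥⇒≼¬ d)
    ... | no ¬d with io-ev (visits _ ¬d) (ev-∩ imp nonzero) 0
    ...   | _ , _ , w≼ , h , w≉⊥ = contradiction
      (B.contradictory (h (B.≼-trans w≼ (B.x∧y≼x _ _))) (B.≼-trans w≼ (B.x∧y≼y _ _))) w≉⊥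

    -- Meets and `⊤` are preserved at every time, joins once the walk decides `x`, `⊥` once it is
    -- nonzero, and complements once both hold.
    η̄-hom : IsBoolHom B.raw PωFin η̄
    η̄-hom = record
      { cong  = λ {x} {y} x≈y → ≐⇒≈ (η̄ x) (η̄ y)
          (η̄-≐ (ev-always λ _ → B.≼-respʳ x≈y , B.≼-respʳ (B.≈-sym x≈y)))
      ; ∨-hom = λ x y → ≐⇒≈ (η̄ (x B.∨ y)) (η̄ x P.∨ η̄ y) (ev-map
          (λ k d → does-⇔ (mk⇔ (B.∨-split d)
            λ { (inj₁ h) → B.≼-trans h (B.x≼x∨y x y) ; (inj₂ h) → B.≼-trans h (B.y≼x∨y x y) })
            em (em ⊎-dec em))
          (decides x))
      ; ∧-hom = λ x y → ≐⇒≈ (η̄ (x B.∧ y)) (η̄ x P.∧ η̄ y) (ev-always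
          λ k → does-⇔ (mk⇔ (λ h → B.≼-trans h (B.x∧y≼x x y) , B.≼-trans h (B.x∧y≼y x y))
            (uncurry B.∧-greatest)) em (em ×-dec em))
      ; ¬-hom = λ x → ≐⇒≈ (η̄ (B.¬ x)) (P.¬ η̄ x) (ev-map
          (λ { k (w≉⊥ , d) → does-⇔ (mk⇔ (λ ≼¬x ≼x → w≉⊥ (B.contradictory ≼x ≼¬x)) (other d)) em (¬? em) })
          (ev-∩ nonzero (decides x)))
      ; ⊤-hom = ≐⇒≈ (η̄ B.⊤) P.⊤ (ev-always λ k → dec-true em (BAProperties.∧-identityʳ B.alg (w k)))
      ; ⊥-hom = ≐⇒≈ (η̄ B.⊥) P.⊥ (ev-map (λ k w≉⊥ → dec-false em (w≉⊥ ∘ B.≼⊥⇒≈⊥)) nonzero) }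
      where
      other : ∀ {v x} → B.Decides v x → Not (v B.≼ x) → v B.≼ B.¬ x
      other (inj₁ h) ¬h = contradiction h ¬h
      other (inj₂ h) _  = h

    η̄-injective : ∀ {x y} → η̄ x P.≈ η̄ y → x B.≈ y
    η̄-injective {x} {y} eq = B.≼-antisym (reflects-≼ (ev-map (λ _ → transfer) eq′))
                                         (reflects-≼ (ev-map (λ _ → transfer ∘ sym) eq′))
      where
      eq′ : η̄ x ≐ η̄ y
      eq′ = ≈⇒≐ (η̄ x) (η̄ y) eq

      transfer : ∀ {x y k} → η̄ x k ≡ η̄ y k → w k B.≼ x → w k B.≼ y
      transfer eq h = η̄-true (trans (sym eq) (dec-true em h))

    η̄-commutes : ∀ x → η̄ (B.aut x) P.≈ σ (η̄ x)
    -- `σ (η̄ x)` at `suc k` is `η̄ x` at `k`, so the two sides are compared at successors.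
    η̄-commutes x = ≐⇒≈ (η̄ (B.aut x)) (σ (η̄ x)) (ev-pred (ev-map equal
      (ev-∩ (decides x) (ev-∩ (step x) (ev-∩ (step (B.¬ x)) (ev-suc nonzero))))))
      where
      -- If the walk were below `¬ x`, the step clause for `¬ x` would put its next, nonzero value
      -- below both `aut x` and its complement.
      back : ∀ {k} → B.Decides (w k) x → (w k B.≼ B.¬ x → w (suc k) B.≼ B.aut (B.¬ x)) →
        Not (w (suc k) B.≈ B.⊥) → w (suc k) B.≼ B.aut x → w k B.≼ x
      back (inj₁ h) _     _   _ = h
      back (inj₂ h) step¬ w≉⊥ g =
        contradiction (B.contradictory g (B.≼-respʳ (β.¬-hom x) (step¬ h))) w≉⊥

      equal : ∀ k → _ → η̄ (B.aut x) (suc k) ≡ η̄ x k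
      equal k (d , step⁺ , step¬ , w≉⊥) = does-⇔ (mk⇔ (back d step¬ w≉⊥) step⁺) em em

    tracks-all : ∀ x → Eventually (λ k → η x k ≡ true → w k B.≼ ι x)
    tracks-all x with a-surj x
    ... | i , ai≈x = ev-map (λ { k (eq , h) ηx → B.≼-respʳ (ι.cong ai≈x) (h (trans eq ηx)) })
      (ev-∩ (η.image-cong ai≈x) (tracks i))

    -- Tracking `x` gives one inclusion; tracking `A.¬ x` gives the other, since `η (A.¬ x)` is
    -- almost the complement of `η x`.
    η̄-extends : ∀ x → η̄ (ι x) P.≈ η x
    η̄-extends x = ≐⇒≈ (η̄ (ι x)) (η x) (ev-map
      (λ { k (pos , neg , ¬-image , w≉⊥) → ⇔→≡ (mk⇔
        (λ η̄ιx → not-injective (¬-not λ ¬ηx → w≉⊥ (B.contradictory (η̄-true η̄ιx)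
          (ι-≼¬ (neg (trans ¬-image ¬ηx))))))
        (λ ηx → dec-true em (pos ηx))) })
      (ev-∩ (tracks-all x) (ev-∩ (tracks-all (A.¬ x)) (ev-∩ (η.image-¬ x) nonzero))))

    extension : ∃ Extension
    extension = η̄ , record { hom = η̄-hom ; injective = η̄-injective ; commutes = η̄-commutes } , η̄-extends

  dagger⇒extension : Countable A.raw → Countable B.raw → Dagger 𝔸 𝔹 ι η → ∃ Extension
  dagger⇒extension (a , a-surj) (e , e-surj) dagger =
    GenericExtension.extension a a-surj e (proj₂ (Walks.generic-walk em em₀ 𝔹 e (η ∘ a) (ι ∘ a)
      e-surj (dagger⇒approximation dagger a e)))

theorem8p8 : ∀ {c ℓ} → ExcludedMiddle (c ⊔ ℓ) →
    (𝔸 𝔹 : DynSys c ℓ) →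
    Countable (DynSys.raw 𝔸) → Countable (DynSys.raw 𝔹) →
    Incompressible (DynSys.raw 𝔸) (DynSys.aut 𝔸) →
    Incompressible (DynSys.raw 𝔹) (DynSys.aut 𝔹) →
    (ι : DynSys.Carrier 𝔸 → DynSys.Carrier 𝔹) →
    IsEmbedding (DynSys.raw 𝔸) (DynSys.raw 𝔹) (DynSys.aut 𝔸) (DynSys.aut 𝔹) ι →
    (η : DynSys.Carrier 𝔸 → ℕ → Bool) →
    IsEmbedding (DynSys.raw 𝔸) PωFin (DynSys.aut 𝔸) σ η →
    ((Σ (DynSys.Carrier 𝔹 → ℕ → Bool) λ η̄ →
    IsEmbedding (DynSys.raw 𝔹) PωFin (DynSys.aut 𝔹) σ η̄ ×
    (∀ a → RawBA._≈_ PωFin (η̄ (ι a)) (η a)))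
    → Dagger 𝔸 𝔹 ι η)
    ×
    (Dagger 𝔸 𝔹 ι η →
    Σ (DynSys.Carrier 𝔹 → ℕ → Bool) λ η̄ →
    IsEmbedding (DynSys.raw 𝔹) PωFin (DynSys.aut 𝔹) σ η̄ ×
    (∀ a → RawBA._≈_ PωFin (η̄ (ι a)) (η a)))
theorem8p8 {c} {ℓ} em 𝔸 𝔹 A-countable B-countable _ _ ι ι-emb η η-emb =
  extension⇒dagger emℓ em₀ 𝔸 𝔹 ι ι-emb η η-emb ,
  dagger⇒extension emℓ em₀ 𝔸 𝔹 ι ι-emb η η-emb A-countable B-countable
  where
  emℓ : ExcludedMiddle ℓ
  emℓ = lower-em c em

  em₀ : ExcludedMiddle 0ℓ
  em₀ = lower-em (c ⊔ ℓ) em
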